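{- Let $\gamma\in\mathcal S_n$. Then $(\varepsilon,\varepsilon,\gamma;(12))\in\mathrm{Par}(n)$ if and only if the cycle structure of $\gamma$ is $2^r\cdot1^f$ for some integers $r\ge0$ and $f\ge1$; that is, $\gamma^2=\varepsilon$ and $\gamma$ has at least one fixed point.
   Context: A Latin square of order $n$ is an $n\times n$ array with rows, columns and symbols indexed by $[n]$, each symbol occurring once in each row and each column, with triple set $O(L)$. Permutations act on the right; $\varepsilon$ is the identity. A paratopism $(\alpha,\beta,\gamma;(12))$ maps $L$ to $L^\sigma$ with triple set $\{(y\beta,x\alpha,z\gamma):(x,y,z)\in O(L)\}$; it is an autoparatopism of $L$ if $L^\sigma=L$. $\mathrm{Par}(n)$ is the set of paratopisms that are autoparatopisms of at least one Latin square of order $n$. Cycle structure $c_1^{\lambda_1}\cdot c_2^{\lambda_2}\cdots$ means $\lambda_i$ cycles of length $c_i$, with fixed points counted as $1$-cycles. -}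

module Defs where

open import Data.Fin using (Fin)
open import Data.Fin.Patterns using (0F; 1F; 2F)
open import Data.Fin.Permutation using (Permutation′; transpose; _⟨$⟩ʳ_; _⟨$⟩ˡ_)
open import Data.List using (List; []; _∷_; _∷ʳ_; map; concat; length; replicate; allFin)
open import Data.List.Relation.Binary.Permutation.Propositional using (_↭_)
open import Data.List.Relation.Unary.All using (All)
open import Data.Nat using (ℕ)
open import Data.Product using (∃; ∃!; ∃-syntax; _×_; _,_)
open import Data.Vec using (Vec; []; _∷_; lookup; tabulate)
open import Level using (0ℓ)
open import Relation.Binary.PropositionalEquality using (_≡_; refl)
open import Relation.Unary using (Pred; _∈_; _≐_)

record LatinSquare (n : ℕ) : Set where
  field
    entry     : Fin n → Fin n → Fin n
    rowLatin  : ∀ x z → ∃! _≡_ λ y → entry x y ≡ z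
    colLatin  : ∀ y z → ∃! _≡_ λ x → entry x y ≡ z

open LatinSquare public

Triple : ℕ → Set
Triple n = Vec (Fin n) 3

O : ∀ {n} → LatinSquare n → Pred (Triple n) 0ℓ
O L (x ∷ y ∷ z ∷ []) = entry L x y ≡ z

-- The right action x α of a permutation is written α ⟨$⟩ʳ x.
record Paratopism (n : ℕ) : Set where
  constructor ⟨_,_,_⨾_⟩
  field
    α β γ : Permutation′ n
    δ     : Permutation′ 3

  component : Fin 3 → Permutation′ n
  component 0F = α
  component 1F = β
  component 2F = γ

  -- The i-th coordinate is moved by the i-th component, then put in position i δ.
  act : Triple n → Triple n
  act t = tabulate λ j → component (δ ⟨$⟩ˡ j) ⟨$⟩ʳ lookup t (δ ⟨$⟩ˡ j)

open Paratopism public using (act)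

[12] : Permutation′ 3
[12] = transpose 0F 1F

act-[12] : ∀ {n} (α β γ : Permutation′ n) x y z →
           act ⟨ α , β , γ ⨾ [12] ⟩ (x ∷ y ∷ z ∷ []) ≡
           (β ⟨$⟩ʳ y) ∷ (α ⟨$⟩ʳ x) ∷ (γ ⟨$⟩ʳ z) ∷ []
act-[12] α β γ x y z = refl

-- The triple set of L^σ.
O^ : ∀ {n} → LatinSquare n → Paratopism n → Pred (Triple n) 0ℓ
O^ L σ t = ∃[ s ] (s ∈ O L × act σ s ≡ t)

IsAutoparatopism : ∀ {n} → Paratopism n → LatinSquare n → Set
IsAutoparatopism σ L = O^ L σ ≐ O L

Par : ∀ n → Pred (Paratopism n) 0ℓ
Par n σ = ∃ λ (L : LatinSquare n) → IsAutoparatopism σ L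

-- A list x₁ ∷ … ∷ x_k ∷ [] with x_i γ = x_{i+1} and x_k γ = x₁. The entries are
-- made distinct by the covering condition in HasCycleStructure.
data IsCycle {n} (γ : Permutation′ n) : List (Fin n) → Set where
  cycle : ∀ {x xs} → map (γ ⟨$⟩ʳ_) (x ∷ xs) ≡ xs ∷ʳ x → IsCycle γ (x ∷ xs)

-- c₁^λ₁ · c₂^λ₂ ⋯ is the list (c₁ , λ₁) ∷ (c₂ , λ₂) ∷ …
CycleStructure : Set
CycleStructure = List (ℕ × ℕ)

cycleLengths : CycleStructure → List ℕ
cycleLengths cs = concat (map (λ (c , m) → replicate m c) cs)

-- γ decomposes into disjoint cycles, jointly covering every point exactly once
-- (fixed points included as 1-cycles), with the prescribed multiset of lengths.
HasCycleStructure : ∀ {n} → Permutation′ n → CycleStructure → Set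
HasCycleStructure {n} γ cs =
  ∃ λ (cycles : List (List (Fin n))) →
    All (IsCycle γ) cycles ×
    concat cycles ↭ allFin n ×
    map length cycles ↭ cycleLengths cs

{-# OPTIONS --safe #-}
module Submission where

-- An autoparatopism (ε, ε, γ; (12)) of L means L(y, x) = γ (L(x, y)): the diagonal then consists of fixed
-- points of γ, and applying the identity twice gives γ² = ε.
--
-- Conversely, start from a symmetric square. A symbol z off the diagonal is a perfect matching of the rows, so
-- z and γ z together form a disjoint union of even cycles, which is two-coloured; replacing z by γ z in the
-- rows of one colour makes the square skew. For even n this applies to a unipotent square whose diagonal symbol
-- is a fixed point e of γ. For odd n, take (x + y) / 2 modulo n, labelled so that e = 0 and γ x = - x on the
-- 2-cycles. Now z and γ z form a path from row z to row γ z (and even cycles). It is closed up by the cell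
-- (z, γ z), whose symbol e moves to the diagonal cells of z and γ z. With an extra vertex ∞ joined to
-- both ends the path becomes an even cycle, so the same two-colouring works.

open import Defs
open import Data.Bool using (Bool; true; false; not)
open import Data.Fin using (Fin; zero; suc; toℕ; fromℕ<; punchOut; join; splitAt; opposite) renaming (_<_ to _<ᶠ_)
open import Data.Fin.Permutation using (Permutation′; id; transpose; _∘ₚ_; _≈_; _⟨$⟩ʳ_)
open import Data.Fin.Properties as Fin using (_≟_; _<?_; <-cmp; any?; pigeonhole; injective⇒≤; punchOut-injective; toℕ-injective; toℕ<n; toℕ-fromℕ<; suc-injective; toℕ-↑ˡ; toℕ-↑ʳ; opposite-prop; opposite-involutive; splitAt-join)
open import Data.List using (List; []; _∷_; _++_; map; concat; filter; length; replicate; allFin)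
open import Data.List.Membership.Propositional using () renaming (_∈_ to _∈ˡ_)
open import Data.List.Membership.Propositional.Properties using (∈-filter⁺; ∈-filter⁻; ∈-allFin; ∈-++⁺ˡ; ∈-++⁺ʳ; ∈-++⁻; ∈-map⁺; ∈-map⁻; ∈-concat⁻′)
open import Data.List.Membership.Propositional.Properties.WithK using (unique⇒irrelevant; unique∧set⇒bag)
open import Data.List.Membership.Setoid.Properties using (index-injective)
open import Data.List.Properties using (length-++; length-map; length-tabulate; map-++; map-∘; concat-++; concat-map-[_]; ++-identityʳ; ∷-injectiveˡ; ∷-injectiveʳ)
open import Data.List.Relation.Binary.BagAndSetEquality using (∼bag⇒↭)
open import Data.List.Relation.Binary.Permutation.Propositional using (_↭_; ↭-refl; ↭-sym; ↭-trans; ↭-reflexive; prep; module PermutationReasoning)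
open import Data.List.Relation.Binary.Permutation.Propositional.Properties using (↭-length; ∈-resp-↭; shift; ++-comm; ++⁺ʳ)
open import Data.List.Relation.Unary.All as All using (All; _∷_)
import Data.List.Relation.Unary.All.Properties as All
open import Data.List.Relation.Unary.AllPairs using (_∷_)
open import Data.List.Relation.Unary.Any using (here; there; index)
open import Data.List.Relation.Unary.Unique.Propositional using (Unique)
import Data.List.Relation.Unary.Unique.Propositional.Properties as Unique
open import Data.Nat using (ℕ; zero; suc; _+_; _*_; _∸_; _⊓_; _<ᵇ_; _≤_; _<_; _≥_; z≤n; s≤s; s≤s⁻¹; NonZero; ∣_-_∣; >-nonZero⁻¹)
open import Data.Nat.Coprimality using (Coprime; coprime-divisor)
open import Data.Nat.DivMod using (_%_; _/_; m≡m%n+[m/n]*n; m%n<n; n%n≡0; _divMod_; result)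
open import Data.Nat.Divisibility using (_∣_; divides; ∣⇒≤; ∣m+n∣m⇒∣n; ∣-trans; n∣m*n; ∣1⇒≡1)
open import Data.Nat.GeneralisedArithmetic using (fold; fold-+)
import Data.Nat.Properties as ℕ
open import Data.Nat.Tactic.RingSolver using (solve-∀)
open import Data.Product using (∃-syntax; _×_; _,_; proj₁; proj₂)
open import Data.Sum using (_⊎_; inj₁; inj₂; map₂)
open import Data.Sum.Properties using (inj₁-injective; inj₂-injective)
open import Data.Vec using ([]; _∷_)
open import Function using (_∘_)
open import Function.Bundles using (_⇔_; mk⇔; Injection)
open import Function.Definitions using (Injective)
open import Function.Properties.Inverse using (↔⇒↣)
open import Relation.Binary.Definitions using (tri<; tri≈; tri>)
open import Relation.Binary.PropositionalEquality using (_≡_; _≢_; refl; sym; trans; cong; cong₂; subst; setoid; module ≡-Reasoning)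
open import Relation.Nullary using (Dec; yes; no; ¬?; _×-dec_; contradiction)
open import Relation.Unary using (_∈_)

private
  variable
    n : ℕ

-- If z were missed, punching z out of the range would give an injection into a set with one element
-- fewer.
injective⇒surjective : {f : Fin n → Fin n} → Injective _≡_ _≡_ f → ∀ z → ∃[ y ] f y ≡ z
injective⇒surjective {suc n} {f} inj z with any? (λ y → f y ≟ z)
... | yes hit  = hit
... | no  miss = contradiction
    (injective⇒≤ {f = λ y → punchOut (z≢f y)} (inj ∘ punchOut-injective (z≢f _) (z≢f _))) ℕ.1+n≰n
  where
  z≢f : ∀ y → z ≢ f y
  z≢f y z≡fy = miss (y , sym z≡fy)

-- Orbits of permutations

minUpTo : (ℕ → ℕ) → ℕ → ℕ
minUpTo f zero    = f zero
minUpTo f (suc k) = f (suc k) ⊓ minUpTo f k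

minUpTo-≤ : ∀ f {k i} → i ≤ k → minUpTo f k ≤ f i
minUpTo-≤ f {zero}  z≤n = ℕ.≤-refl
minUpTo-≤ f {suc k} {i} i≤1+k with ℕ.m≤n⇒m<n∨m≡n i≤1+k
... | inj₁ (s≤s i≤k) = ℕ.≤-trans (ℕ.m⊓n≤n _ _) (minUpTo-≤ f i≤k)
... | inj₂ refl      = ℕ.m⊓n≤m _ _

minUpTo-attained : ∀ f k → ∃[ i ] i ≤ k × minUpTo f k ≡ f i
minUpTo-attained f zero = 0 , z≤n , refl
minUpTo-attained f (suc k) with ℕ.⊓-sel (f (suc k)) (minUpTo f k)
... | inj₁ eq = suc k , ℕ.≤-refl , eq
... | inj₂ eq with i , i≤k , eq′ ← minUpTo-attained f k = i , ℕ.m≤n⇒m≤1+n i≤k , trans eq eq′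

minUpTo-mono : ∀ f g k → (∀ i → i ≤ k → ∃[ j ] j ≤ k × g i ≡ f j) → minUpTo f k ≤ minUpTo g k
minUpTo-mono f g k sub with i , i≤k , eq ← minUpTo-attained g k with j , j≤k , eq′ ← sub i i≤k =
  subst (minUpTo f k ≤_) (sym (trans eq eq′)) (minUpTo-≤ f j≤k)

fold-pull : ∀ (p : Fin n → Fin n) x k → fold (p x) p k ≡ p (fold x p k)
fold-pull p x zero    = refl
fold-pull p x (suc k) = cong p (fold-pull p x k)

module _ {p : Fin n → Fin n} (p-injective : Injective _≡_ _≡_ p) where

  fold-injective : ∀ k → Injective _≡_ _≡_ (λ x → fold x p k)
  fold-injective zero    eq = eq
  fold-injective (suc k) eq = fold-injective k (p-injective eq)

  -- Two of the n + 1 iterates 0, ..., n of x coincide, and injectivity cancels the smaller number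
  -- of steps. The bound by n is what lets `orbitMin` stop at n.
  period : ∀ x → ∃[ d ] suc d ≤ n × fold x p (suc d) ≡ x
  period x with i , j , i<j , eq ← pigeonhole (ℕ.n<1+n n) (λ k → fold x p (toℕ k))
           with d , refl′ ← ℕ.m≤n⇒∃[o]m+o≡n i<j =
    d , ℕ.≤-trans (s≤s (ℕ.m≤n+m d (toℕ i))) (subst (_≤ n) (sym refl′) (s≤s⁻¹ (toℕ<n j))) ,
    fold-injective (toℕ i) (begin
      fold (fold x p (suc d)) p (toℕ i) ≡⟨ fold-+ x p (toℕ i) ⟨
      fold x p (toℕ i + suc d)          ≡⟨ cong (fold x p) (trans (ℕ.+-suc (toℕ i) d) refl′) ⟩
      fold x p (toℕ j)                  ≡⟨ eq ⟨
      fold x p (toℕ i)                  ∎)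
    where open ≡-Reasoning

-- Periods are at most n, so the iterates 0, ..., n run through the whole orbit.
orbitMin : (Fin n → Fin n) → Fin n → ℕ
orbitMin {n} p x = minUpTo (λ k → toℕ (fold x p k)) n

orbitMin-invariant : {p : Fin n → Fin n} → Injective _≡_ _≡_ p → ∀ x → orbitMin p (p x) ≡ orbitMin p x
orbitMin-invariant {n} {p} p-injective x with d , d<n , eq ← period p-injective x =
  ℕ.≤-antisym (minUpTo-mono _ _ n forth) (minUpTo-mono _ _ n back)
  where
  forth : ∀ i → i ≤ n → ∃[ j ] j ≤ n × toℕ (fold x p i) ≡ toℕ (fold (p x) p j)
  forth zero    _   = d , ℕ.<⇒≤ d<n , cong toℕ (sym (trans (fold-pull p x d) eq))
  forth (suc i) i<n = i , ℕ.<⇒≤ i<n , cong toℕ (sym (fold-pull p x i))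

  back : ∀ i → i ≤ n → ∃[ j ] j ≤ n × toℕ (fold (p x) p i) ≡ toℕ (fold x p j)
  back i i≤n with ℕ.m≤n⇒m<n∨m≡n i≤n
  ... | inj₁ i<n  = suc i , i<n , cong toℕ (fold-pull p x i)
  -- Iterate n of `p x` is iterate n + 1 of x, one step out of range; going back a full period of d
  -- + 1 steps gives n - d.
  ... | inj₂ refl = n ∸ d , ℕ.m∸n≤m n d , cong toℕ (begin
    fold (p x) p n                    ≡⟨ fold-pull p x n ⟩
    fold x p (suc n)                  ≡⟨ cong (fold x p) (trans (ℕ.+-suc (n ∸ d) d) (cong suc (ℕ.m∸n+n≡m (ℕ.<⇒≤ d<n)))) ⟨
    fold x p (n ∸ d + suc d)          ≡⟨ fold-+ x p (n ∸ d) ⟩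
    fold (fold x p (suc d)) p (n ∸ d) ≡⟨ cong (λ y → fold y p (n ∸ d)) eq ⟩
    fold x p (n ∸ d)                  ∎)
    where open ≡-Reasoning

-- Two-colouring the union of two perfect matchings

-- Every component is a cycle consisting of two orbits of β ∘ α, which α and β interchange; its two colour
-- classes are these orbits, and the one with the smaller minimum is coloured true.
colouring : (α β : Fin n → Fin n) → Fin n → Bool
colouring α β x = orbitMin (β ∘ α) x <ᵇ orbitMin (β ∘ α) (α x)

<ᵇ-swap : ∀ {a b} → a ≢ b → (b <ᵇ a) ≡ not (a <ᵇ b)
<ᵇ-swap {zero}  {zero}  a≢b = contradiction refl a≢b
<ᵇ-swap {zero}  {suc b} a≢b = refl
<ᵇ-swap {suc a} {zero}  a≢b = refl
<ᵇ-swap {suc a} {suc b} a≢b = <ᵇ-swap (a≢b ∘ cong suc)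

module Matchings {α β : Fin n → Fin n}
  (α-involutive : ∀ x → α (α x) ≡ x) (β-involutive : ∀ x → β (β x) ≡ x)
  (α-free : ∀ x → α x ≢ x) (β-free : ∀ x → β x ≢ x) where

  p : Fin n → Fin n
  p = β ∘ α

  p-inverse : ∀ x → α (β (p x)) ≡ x
  p-inverse x = trans (cong α (β-involutive (α x))) (α-involutive x)

  p-injective : Injective _≡_ _≡_ p
  p-injective {x} {y} eq = trans (sym (p-inverse x)) (trans (cong (α ∘ β) eq) (p-inverse y))

  -- Cancelling the outermost `p` replaces x by `p x` and lowers the exponent by two. The descent
  -- ends at a fixed point of α or of β.
  rotation≢reflection : ∀ k x → fold x p k ≢ α x
  rotation≢reflection zero          x eq = α-free x (sym eq)
  rotation≢reflection (suc zero)    x eq = β-free (α x) eq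
  rotation≢reflection (suc (suc k)) x eq = rotation≢reflection k (p x)
    (trans (fold-pull p x k) (trans (sym (p-inverse _)) (cong (α ∘ β) eq)))

  -- The dihedral relation: α conjugates `p` to its inverse.
  conjugate : ∀ j y → fold (α (fold y p j)) p j ≡ α y
  conjugate zero    y = refl
  conjugate (suc j) y = begin
    p (fold (α (p (fold y p j))) p j) ≡⟨ fold-pull p _ j ⟨
    fold (p (α (p (fold y p j)))) p j ≡⟨ cong (λ z → fold z p j) (trans (cong β (α-involutive _)) (β-involutive _)) ⟩
    fold (α (fold y p j)) p j         ≡⟨ conjugate j y ⟩
    α y                               ∎
    where open ≡-Reasoning

  orbits-disjoint : ∀ i j x → fold x p i ≢ fold (α x) p j
  -- With x written as the j-th iterate of y, the right side becomes `α y` by `conjugate`, and the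
  -- left side the (i + j)-th iterate of y.
  orbits-disjoint i j x eq with y , refl ← injective⇒surjective (fold-injective p-injective j) x =
    rotation≢reflection (i + j) y (trans (fold-+ y p i) (trans eq (conjugate j y)))

  orbitMin-α : ∀ x → orbitMin p x ≢ orbitMin p (α x)
  orbitMin-α x eq
    with i , _ , eqᵢ ← minUpTo-attained (λ k → toℕ (fold x p k)) n
       | j , _ , eqⱼ ← minUpTo-attained (λ k → toℕ (fold (α x) p k)) n =
    orbits-disjoint i j x (toℕ-injective (trans (sym eqᵢ) (trans eq eqⱼ)))

  colouring-α : ∀ x → colouring α β (α x) ≡ not (colouring α β x)
  colouring-α x rewrite α-involutive x = <ᵇ-swap (orbitMin-α x)

  -- `β x` is `p (α x)`, in the orbit of `α x`, while `p` maps `α (β x)` to x. So β interchanges the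
  -- same two orbits as α.
  colouring-β : ∀ x → colouring α β (β x) ≡ not (colouring α β x)
  colouring-β x = trans (cong₂ _<ᵇ_ min-β min-αβ) (<ᵇ-swap (orbitMin-α x))
    where
    min-β : orbitMin p (β x) ≡ orbitMin p (α x)
    min-β = trans (cong (orbitMin p ∘ β) (sym (α-involutive x))) (orbitMin-invariant p-injective (α x))
    min-αβ : orbitMin p (α (β x)) ≡ orbitMin p x
    min-αβ = trans (sym (orbitMin-invariant p-injective _))
                   (cong (orbitMin p) (trans (cong β (α-involutive _)) (β-involutive x)))

-- Symmetric Latin squares

-- By finiteness, cancellation makes every row a permutation; commutativity carries this over to the
-- columns.
record SymmetricSquare (n : ℕ) : Set where
  field
    _∙_    : Fin n → Fin n → Fin n
    comm   : ∀ x y → x ∙ y ≡ y ∙ x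
    cancel : ∀ x {y z} → x ∙ y ≡ x ∙ z → y ≡ z

  -- The symbol u joins row x to row `partner u x`. By symmetry this is a matching, with loops at
  -- the diagonal cells that hold u.
  partner : Fin n → Fin n → Fin n
  partner u x = proj₁ (injective⇒surjective (cancel x) u)

  ∙-partner : ∀ u x → x ∙ partner u x ≡ u
  ∙-partner u x = proj₂ (injective⇒surjective (cancel x) u)

  partner-unique : ∀ {u x y} → x ∙ y ≡ u → y ≡ partner u x
  partner-unique {u} {x} eq = cancel x (trans eq (sym (∙-partner u x)))

  partner-involutive : ∀ u x → partner u (partner u x) ≡ x
  partner-involutive u x = sym (partner-unique (trans (comm _ x) (∙-partner u x)))

  opaque
    colour : (u v : Fin n) → Fin n → Bool
    colour u v = colouring (partner u) (partner v)

  module _ {d} (unipotent : ∀ x → x ∙ x ≡ d) where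

    partner-free : ∀ {u} → u ≢ d → ∀ x → partner u x ≢ x
    partner-free {u} u≢d x eq = u≢d (trans (sym (∙-partner u x)) (trans (cong (x ∙_) eq) (unipotent x)))

    opaque
      unfolding colour
      colour-alternates : ∀ {u v} → u ≢ d → v ≢ d → ∀ {x y} → x ∙ y ≡ u ⊎ x ∙ y ≡ v →
                          colour u v y ≡ not (colour u v x)
      colour-alternates {u} {v} u≢d v≢d {x} = λ where
          (inj₁ eq) → trans (cong (colour u v) (partner-unique eq)) (colouring-α x)
          (inj₂ eq) → trans (cong (colour u v) (partner-unique eq)) (colouring-β x)
        where open Matchings (partner-involutive u) (partner-involutive v) (partner-free u≢d) (partner-free v≢d)

-- Arithmetic means modulo an odd number, and adjoining a point

≡%⇒∣ : ∀ a b m .{{_ : NonZero m}} → a % m ≡ b % m → m ∣ ∣ a - b ∣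
≡%⇒∣ a b m eq = divides ∣ a / m - b / m ∣ (begin
  ∣ a - b ∣                                 ≡⟨ cong₂ ∣_-_∣ (m≡m%n+[m/n]*n a m) (m≡m%n+[m/n]*n b m) ⟩
  ∣ a % m + a / m * m - b % m + b / m * m ∣ ≡⟨ cong (λ c → ∣ a % m + a / m * m - c + b / m * m ∣) eq ⟨
  ∣ a % m + a / m * m - a % m + b / m * m ∣ ≡⟨ ℕ.∣m+n-m+o∣≡∣n-o∣ (a % m) _ _ ⟩
  ∣ a / m * m - b / m * m ∣                 ≡⟨ ℕ.*-distribʳ-∣-∣ m (a / m) (b / m) ⟨
  ∣ a / m - b / m ∣ * m                     ∎)
  where open ≡-Reasoning

∣distance⇒≡ : ∀ {a b m} → a < m → b < m → m ∣ ∣ a - b ∣ → a ≡ b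
∣distance⇒≡ {a} {b} {m} a<m b<m m∣ with ∣ a - b ∣ in eq
... | zero  = ℕ.∣m-n∣≡0⇒m≡n eq
... | suc k = contradiction (∣⇒≤ m∣) (ℕ.<⇒≱ (subst (_< m) eq (ℕ.≤-<-trans (ℕ.∣m-n∣≤m⊔n a b) (ℕ.⊔-lub a<m b<m))))

odd-coprime-2 : ∀ k → Coprime (suc (k * 2)) 2
odd-coprime-2 k {d} (d∣odd , d∣2) = ∣1⇒≡1 (∣m+n∣m⇒∣n (subst (d ∣_) (ℕ.+-comm 1 (k * 2)) d∣odd) (∣-trans d∣2 (n∣m*n k)))

-- The square (x + y) / 2 modulo an odd number, in terms of labels ρ of the points.
module Mean {m} .{{_ : NonZero m}} (m-odd : Coprime m 2)
  {ρ : Fin m → ℕ} (ρ<m : ∀ x → ρ x < m) (ρ-injective : Injective _≡_ _≡_ ρ) where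

  sum : Fin m → Fin m → Fin m
  sum x y = fromℕ< (m%n<n (ρ x + ρ y) m)

  sum-%  : ∀ {w x y z} → sum w x ≡ sum y z → (ρ w + ρ x) % m ≡ (ρ y + ρ z) % m
  sum-% eq = trans (sym (toℕ-fromℕ< _)) (trans (cong toℕ eq) (toℕ-fromℕ< _))

  %-sum : ∀ {w x y z} → (ρ w + ρ x) % m ≡ (ρ y + ρ z) % m → sum w x ≡ sum y z
  %-sum eq = toℕ-injective (trans (toℕ-fromℕ< _) (trans eq (sym (toℕ-fromℕ< _))))

  sum-cancel : ∀ x {y z} → sum x y ≡ sum x z → y ≡ z
  sum-cancel x {y} {z} eq = ρ-injective (∣distance⇒≡ (ρ<m y) (ρ<m z)
    (subst (m ∣_) (ℕ.∣m+n-m+o∣≡∣n-o∣ (ρ x) (ρ y) (ρ z)) (≡%⇒∣ (ρ x + ρ y) (ρ x + ρ z) m (sum-% eq))))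

  double-injective : Injective _≡_ _≡_ (λ x → sum x x)
  double-injective {x} {y} eq = ρ-injective (∣distance⇒≡ (ρ<m x) (ρ<m y) (coprime-divisor m-odd
    (subst (m ∣_) distance (≡%⇒∣ (ρ x + ρ x) (ρ y + ρ y) m (sum-% eq)))))
    where
    x+x≡2*x : ∀ x → x + x ≡ 2 * x
    x+x≡2*x x = cong (x +_) (sym (ℕ.+-identityʳ x))
    distance : ∣ ρ x + ρ x - ρ y + ρ y ∣ ≡ 2 * ∣ ρ x - ρ y ∣
    distance = trans (cong₂ ∣_-_∣ (x+x≡2*x (ρ x)) (x+x≡2*x (ρ y))) (sym (ℕ.*-distribˡ-∣-∣ 2 (ρ x) (ρ y)))

  -- `sum` takes points to a residue, and `half` leads from residues back to points, so `half` after
  -- `sum` is an operation on points.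
  half : Fin m → Fin m
  half z = proj₁ (injective⇒surjective double-injective z)

  double-half : ∀ z → sum (half z) (half z) ≡ z
  double-half z = proj₂ (injective⇒surjective double-injective z)

  mean : SymmetricSquare m
  mean = record
    { _∙_    = λ x y → half (sum x y)
    ; comm   = λ x y → cong half (%-sum {x} {y} {y} {x} (cong (_% m) (ℕ.+-comm (ρ x) (ρ y))))
    ; cancel = λ x eq → sum-cancel x (trans (sym (double-half _)) (trans (cong (λ z → sum z z) eq) (double-half _)))
    }

  open SymmetricSquare mean

  -- `half` is given only as the inverse of doubling, so a product is recognised by its double.
  mean-unique : ∀ {x y z} → (ρ x + ρ y) % m ≡ (ρ z + ρ z) % m → x ∙ y ≡ z
  mean-unique {x} {y} {z} eq = double-injective (trans (double-half _) (%-sum {x} {y} {z} {z} eq))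

  mean-idempotent : ∀ x → x ∙ x ≡ x
  mean-idempotent x = mean-unique refl

-- Adjoining a point zero = ∞ to an idempotent square makes it unipotent.
module Extension (Q : SymmetricSquare n) (idempotent : ∀ x → SymmetricSquare._∙_ Q x x ≡ x) where

  open SymmetricSquare Q

  -- Each diagonal symbol x ∙ x = x moves out to the border cells that x shares with ∞, and ∞ fills
  -- the diagonal.
  _∙̂_ : Fin (suc n) → Fin (suc n) → Fin (suc n)
  zero  ∙̂ y     = y
  suc x ∙̂ zero  = suc x
  suc x ∙̂ suc y with x ≟ y
  ... | yes _ = zero
  ... | no  _ = suc (x ∙ y)

  extension-unipotent : ∀ x → x ∙̂ x ≡ zero
  extension-unipotent zero    = refl
  extension-unipotent (suc x) with x ≟ x
  ... | yes _   = refl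
  ... | no  x≢x = contradiction refl x≢x

  extension-suc : ∀ {x y} → x ≢ y → suc x ∙̂ suc y ≡ suc (x ∙ y)
  extension-suc {x} {y} x≢y with x ≟ y
  ... | yes x≡y = contradiction x≡y x≢y
  ... | no  _   = refl

  extension-comm : ∀ x y → x ∙̂ y ≡ y ∙̂ x
  extension-comm zero    zero    = refl
  extension-comm zero    (suc y) = refl
  extension-comm (suc x) zero    = refl
  extension-comm (suc x) (suc y) with x ≟ y | y ≟ x
  ... | yes _   | yes _   = refl
  ... | yes x≡y | no  y≢x = contradiction (sym x≡y) y≢x
  ... | no  x≢y | yes y≡x = contradiction (sym y≡x) x≢y
  ... | no  _   | no  _   = cong suc (comm x y)

  -- In the mixed cases the border symbol x would also occur off the diagonal of row x, although x ∙
  -- x = x already holds it in the old square.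
  extension-cancel : ∀ x {y z} → x ∙̂ y ≡ x ∙̂ z → y ≡ z
  extension-cancel zero    eq = eq
  extension-cancel (suc x) {zero} {zero} eq = refl
  extension-cancel (suc x) {zero} {suc z} eq with x ≟ z
  ... | no x≢z = contradiction (cancel x (trans (idempotent x) (suc-injective eq))) x≢z
  extension-cancel (suc x) {suc y} {zero} eq with x ≟ y
  ... | no x≢y = contradiction (cancel x (trans (idempotent x) (suc-injective (sym eq)))) x≢y
  extension-cancel (suc x) {suc y} {suc z} eq with x ≟ y | x ≟ z
  ... | yes x≡y | yes x≡z = cong suc (trans (sym x≡y) x≡z)
  ... | no  _   | no  _   = cong suc (cancel x (suc-injective eq))

  extension : SymmetricSquare (suc n)
  extension = record { _∙_ = _∙̂_ ; comm = extension-comm ; cancel = extension-cancel }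

-- Skew squares by twisting symmetric ones

involutive⇒injective : (g : Fin n → Fin n) → (∀ x → g (g x) ≡ x) → Injective _≡_ _≡_ g
involutive⇒injective g inv {x} {y} eq = trans (sym (inv x)) (trans (cong g eq) (inv y))

Skew : (Fin n → Fin n) → (Fin n → Fin n → Fin n) → Set
Skew g T = ∀ x y → T y x ≡ g (T x y)

-- Only the rows are asked to be Latin: by skewness, column y is row y followed by g.
SkewSquare : (Fin n → Fin n) → Set
SkewSquare {n} g = ∃[ T ] (∀ (x : Fin n) → Injective _≡_ _≡_ (T x)) × Skew g T

module Twist (g : Fin n → Fin n) (inv : ∀ x → g (g x) ≡ x) where

  -- The smaller of z and g z, so that both symbols of a 2-cycle share one colouring.
  key : Fin n → Fin n
  key z with <-cmp z (g z)
  ... | tri< _ _ _ = z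
  ... | tri≈ _ _ _ = z
  ... | tri> _ _ _ = g z

  key-g : ∀ z → key (g z) ≡ key z
  key-g z with <-cmp z (g z) | <-cmp (g z) (g (g z))
  ... | tri< lt _ _ | tri< lt′ _ _ = contradiction (subst (g z <ᶠ_) (inv z) lt′) (Fin.<-asym lt)
  ... | tri< lt _ _ | tri≈ _ eq _  = contradiction (sym (trans eq (inv z))) (Fin.<⇒≢ lt)
  ... | tri< _ _ _  | tri> _ _ _   = inv z
  ... | tri≈ _ eq _ | tri< _ _ _   = sym eq
  ... | tri≈ _ eq _ | tri≈ _ _ _   = sym eq
  ... | tri≈ _ eq _ | tri> _ _ _   = inv z
  ... | tri> _ _ _  | tri< _ _ _   = refl
  ... | tri> _ _ _  | tri≈ _ _ _   = refl
  ... | tri> _ _ gt | tri> _ _ gt′ = contradiction (subst (_<ᶠ g z) (inv z) gt′) (Fin.<-asym gt)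

  key-pair : ∀ z → z ≡ key z ⊎ z ≡ g (key z)
  key-pair z with <-cmp z (g z)
  ... | tri< _ _ _ = inj₁ refl
  ... | tri≈ _ _ _ = inj₁ refl
  ... | tri> _ _ _ = inj₂ (sym (inv z))

  twist : Bool → Fin n → Fin n
  twist true  z = z
  twist false z = g z

  twist-involutive : ∀ b z → twist b (twist b z) ≡ z
  twist-involutive true  z = refl
  twist-involutive false z = inv z

  twist-fixed : ∀ b {z} → g z ≡ z → twist b z ≡ z
  twist-fixed true  eq = refl
  twist-fixed false eq = eq

  twist-g : ∀ b z → twist b (g z) ≡ g (twist b z)
  twist-g true  z = refl
  twist-g false z = refl

  twist-not : ∀ b z → twist (not b) z ≡ g (twist b z)
  twist-not true  z = refl
  twist-not false z = sym (inv z)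

  key-twist : ∀ b z → key (twist b z) ≡ key z
  key-twist true  z = refl
  key-twist false z = key-g z

  module _ (c : Fin n → Fin n → Bool) where

    twistRow : Fin n → Fin n → Fin n
    twistRow x z = twist (c (key z) x) z

    -- A twist stays inside the pair of z and `g z`, so it preserves the key and hence the colour:
    -- row x swaps both symbols of a pair or neither.
    twistRow-involutive : ∀ x z → twistRow x (twistRow x z) ≡ z
    twistRow-involutive x z = trans (cong (λ k → twist (c k x) (twistRow x z)) (key-twist (c (key z) x) z))
                                    (twist-involutive (c (key z) x) z)

    twistRow-injective : ∀ x → Injective _≡_ _≡_ (twistRow x)
    twistRow-injective x = involutive⇒injective (twistRow x) (twistRow-involutive x)

-- Autoparatopisms as skewness

module _ (γ : Permutation′ n) where

  private
    g : Fin n → Fin n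
    g = γ ⟨$⟩ʳ_

  skew⇒Par : (∀ x → g (g x) ≡ x) → SkewSquare g → ⟨ id , id , γ ⨾ [12] ⟩ ∈ Par n
  skew⇒Par inv (T , T-cancel , skew) = L , to , from
    where
    row : ∀ x z → ∃[ y ] T x y ≡ z
    row x = injective⇒surjective (T-cancel x)

    L : LatinSquare n
    L = record
      { entry    = T
      ; rowLatin = λ x z → let y , eq = row x z in y , eq , λ eq′ → T-cancel x (trans eq (sym eq′))
      -- The symbol z stands in column y where `g z` stands in row y.
      ; colLatin = λ y z → let x , eq = row y (g z) in
          x , trans (skew y x) (trans (cong g eq) (inv z)) ,
          λ {x′} eq′ → T-cancel y (trans eq (trans (cong g (sym eq′)) (sym (skew x′ y))))
      }

    to : ∀ {t} → t ∈ O^ L ⟨ id , id , γ ⨾ [12] ⟩ → t ∈ O L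
    to ((x ∷ y ∷ z ∷ []) , eq , refl) = trans (skew x y) (cong g eq)

    from : ∀ {t} → t ∈ O L → t ∈ O^ L ⟨ id , id , γ ⨾ [12] ⟩
    from {x ∷ y ∷ z ∷ []} eq = (y ∷ x ∷ g z ∷ []) , trans (skew x y) (cong g eq) ,
                               cong (λ w → x ∷ y ∷ w ∷ []) (inv z)

  Par⇒skew : ((L , _) : ⟨ id , id , γ ⨾ [12] ⟩ ∈ Par n) → Skew g (entry L)
  Par⇒skew (L , to , _) x y = to ((x ∷ y ∷ entry L x y ∷ []) , refl , refl)

-- Even order: a unipotent square whose diagonal symbol is fixed by g.
module _ (g : Fin n → Fin n) (inv : ∀ x → g (g x) ≡ x) (Q : SymmetricSquare n)
         {d} (gd≡d : g d ≡ d) (unipotent : ∀ x → SymmetricSquare._∙_ Q x x ≡ d) where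

  open SymmetricSquare Q
  open Twist g inv

  unipotentColour : Fin n → Fin n → Bool
  unipotentColour z = colour z (g z)

  unipotent-skew : Skew g (λ x y → twistRow unipotentColour x (x ∙ y))
  unipotent-skew x y rewrite comm y x with x ∙ y in eq
  ... | z with z ≟ d
  -- Twisting leaves the diagonal symbol alone, whatever the colours.
  ... | yes refl = trans (twist-fixed (b y) gd≡d) (sym (trans (cong g (twist-fixed (b x) gd≡d)) gd≡d))
    where
    b : Fin n → Bool
    b = unipotentColour (key d)
  -- The cell is an edge in the union of the matchings of `key z` and `g (key z)`, so its ends
  -- differ in colour and exactly one of the two rows is twisted.
  ... | no  z≢d  = trans (cong (λ b → twist b z) (colour-alternates unipotent k≢d gk≢d edge))
                         (twist-not (unipotentColour (key z) x) z)
    where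
    gk≢d : g (key z) ≢ d
    gk≢d e with key-pair z
    ... | inj₁ z≡k  = z≢d (trans z≡k (involutive⇒injective g inv (trans e (sym gd≡d))))
    ... | inj₂ z≡gk = z≢d (trans z≡gk e)
    k≢d : key z ≢ d
    k≢d e = gk≢d (trans (cong g e) gd≡d)
    edge : x ∙ y ≡ key z ⊎ x ∙ y ≡ g (key z)
    edge rewrite eq = key-pair z

  unipotent⇒skewSquare : SkewSquare g
  unipotent⇒skewSquare = _ , (λ x → cancel x ∘ twistRow-injective unipotentColour x) , unipotent-skew

-- Odd order: an idempotent square in which the two points of every 2-cycle of g have product e, and zero plays ∞.
module _ (g : Fin n → Fin n) (inv : ∀ x → g (g x) ≡ x) (Q : SymmetricSquare n)
         (idempotent : ∀ x → SymmetricSquare._∙_ Q x x ≡ x) {e} (ge≡e : g e ≡ e)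
         (∙-cycle : ∀ {x} → g x ≢ x → SymmetricSquare._∙_ Q x (g x) ≡ e) where

  open SymmetricSquare Q
  open Twist g inv
  open Extension Q idempotent
  private
    module Q̂ = SymmetricSquare extension

  idempotentColour : Fin n → Fin n → Bool
  idempotentColour z x = Q̂.colour (suc z) (suc (g z)) (suc x)

  -- If g moves x, then the columns x and `g x` trade symbols in row x: e arrives on the diagonal
  -- and x at the cell (x, g x). If g fixes x, nothing changes.
  swapRow : Fin n → Fin n → Fin n
  swapRow x y = x ∙ (transpose x (g x) ⟨$⟩ʳ y)

  swapRow-cancel : ∀ x → Injective _≡_ _≡_ (swapRow x)
  swapRow-cancel x eq = Injection.injective (↔⇒↣ (transpose x (g x))) (cancel x eq)

  swapRow-diagonal : ∀ x → g (swapRow x x) ≡ swapRow x x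
  swapRow-diagonal x with x ≟ x
  ... | no x≢x = contradiction refl x≢x
  ... | yes _ with g x ≟ x
  ... | yes gx≡x rewrite gx≡x | idempotent x = gx≡x
  ... | no  gx≢x rewrite ∙-cycle gx≢x = ge≡e

  swapRow-cycle : ∀ x → g x ≢ x → swapRow x (g x) ≡ x
  swapRow-cycle x gx≢x with g x ≟ x
  ... | yes gx≡x = contradiction gx≡x gx≢x
  ... | no  _ with g x ≟ g x
  ... | yes _ = idempotent x
  ... | no ne = contradiction refl ne

  swapRow-other : ∀ {x y} → y ≢ x → y ≢ g x → swapRow x y ≡ x ∙ y
  swapRow-other {x} {y} y≢x y≢gx with y ≟ x
  ... | yes y≡x = contradiction y≡x y≢x
  ... | no  _ with y ≟ g x
  ... | yes y≡gx = contradiction y≡gx y≢gx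
  ... | no  _ = refl

  colour-edge : ∀ {u v} x y → x Q̂.∙ y ≡ suc u ⊎ x Q̂.∙ y ≡ suc v →
                Q̂.colour (suc u) (suc v) y ≡ not (Q̂.colour (suc u) (suc v) x)
  colour-edge x y = Q̂.colour-alternates extension-unipotent (λ ()) (λ ()) {x} {y}

  private
    T : Fin n → Fin n → Fin n
    T x y = twistRow idempotentColour x (swapRow x y)

  -- x and g x are both joined to ∞ by the symbols x and g x, so they get the same colour.
  colour-cycle : ∀ x → idempotentColour (key x) (g x) ≡ idempotentColour (key x) x
  colour-cycle x = trans (colour-edge zero (suc (g x)) (joined (g x) (key-g x)))
                         (sym (colour-edge zero (suc x) (joined x refl)))
    where
    joined : ∀ y → key y ≡ key x → zero Q̂.∙ suc y ≡ suc (key x) ⊎ zero Q̂.∙ suc y ≡ suc (g (key x))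
    joined y eq with key-pair y
    ... | inj₁ y≡k  = inj₁ (cong suc (trans y≡k eq))
    ... | inj₂ y≡gk = inj₂ (cong suc (trans y≡gk (cong g eq)))

  skew-diagonal : ∀ x → T x x ≡ g (T x x)
  skew-diagonal x = trans Txx (trans (sym fixed) (cong g (sym Txx)))
    where
    fixed : g (swapRow x x) ≡ swapRow x x
    fixed = swapRow-diagonal x
    Txx : T x x ≡ swapRow x x
    Txx = twist-fixed (idempotentColour (key (swapRow x x)) x) fixed

  -- After the swap the cells (x, g x) and (g x, x) hold x and `g x`, which is already skew; equal
  -- colours twist both or neither.
  skew-cycle : ∀ x → g x ≢ x → T (g x) x ≡ g (T x (g x))
  skew-cycle x gx≢x = begin
    T (g x) x                                        ≡⟨ cong (twistRow idempotentColour (g x)) swapped ⟩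
    twist (idempotentColour (key (g x)) (g x)) (g x) ≡⟨ cong (λ k → twist (idempotentColour k (g x)) (g x)) (key-g x) ⟩
    twist (idempotentColour (key x) (g x)) (g x)     ≡⟨ cong (λ b → twist b (g x)) (colour-cycle x) ⟩
    twist (idempotentColour (key x) x) (g x)         ≡⟨ twist-g (idempotentColour (key x) x) x ⟩
    g (twist (idempotentColour (key x) x) x)         ≡⟨ cong (g ∘ twistRow idempotentColour x) (swapRow-cycle x gx≢x) ⟨
    g (T x (g x))                                    ∎
    where
    open ≡-Reasoning
    swapped : swapRow (g x) x ≡ g x
    swapped = trans (cong (swapRow (g x)) (sym (inv x)))
                    (swapRow-cycle (g x) (λ eq → gx≢x (involutive⇒injective g inv eq)))

  -- The swap spares both cells. Off the diagonal the extended square holds the same symbol, so x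
  -- and y have opposite colours.
  skew-other : ∀ {x y} → y ≢ x → y ≢ g x → T y x ≡ g (T x y)
  skew-other {x} {y} y≢x y≢gx = begin
    T y x                                      ≡⟨ cong (twistRow idempotentColour y) yx≡z ⟩
    twist (idempotentColour (key z) y) z       ≡⟨ cong (λ b → twist b z) (colour-edge (suc x) (suc y) edge) ⟩
    twist (not (idempotentColour (key z) x)) z ≡⟨ twist-not (idempotentColour (key z) x) z ⟩
    g (twist (idempotentColour (key z) x) z)   ≡⟨ cong (g ∘ twistRow idempotentColour x) (swapRow-other y≢x y≢gx) ⟨
    g (T x y)                                  ∎
    where
    open ≡-Reasoning
    z : Fin n
    z = x ∙ y
    x≢gy : x ≢ g y
    x≢gy eq = y≢gx (trans (sym (inv y)) (cong g (sym eq)))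
    yx≡z : swapRow y x ≡ z
    yx≡z = trans (swapRow-other (y≢x ∘ sym) x≢gy) (comm y x)
    edge : suc x Q̂.∙ suc y ≡ suc (key z) ⊎ suc x Q̂.∙ suc y ≡ suc (g (key z))
    edge rewrite extension-suc (y≢x ∘ sym) with key-pair z
    ... | inj₁ z≡k  = inj₁ (cong suc z≡k)
    ... | inj₂ z≡gk = inj₂ (cong suc z≡gk)

  idempotent-skew : Skew g T
  idempotent-skew x y = cases (y ≟ x) (y ≟ g x)
    where
    cases : Dec (y ≡ x) → Dec (y ≡ g x) → T y x ≡ g (T x y)
    cases (yes refl) _          = skew-diagonal y
    cases (no y≢x)   (yes refl) = skew-cycle x y≢x
    cases (no y≢x)   (no y≢gx)  = skew-other y≢x y≢gx

  idempotent⇒skewSquare : SkewSquare g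
  idempotent⇒skewSquare =
    T , (λ x → swapRow-cancel x ∘ twistRow-injective idempotentColour x) , idempotent-skew

-- Labelling the points of an involution

module Involution (g : Fin n → Fin n) (inv : ∀ x → g (g x) ≡ x) {e} (ge≡e : g e ≡ e) where

  lower fixed : List (Fin n)
  lower = filter (λ x → x <? g x) (allFin n)
  fixed = filter (λ x → (g x ≟ x) ×-dec ¬? (x ≟ e)) (allFin n)

  -- The membership proofs record positions in the lists, from which the labels are built.
  data Class (x : Fin n) : Set where
    isE     : x ≡ e → Class x
    isLower : x ∈ˡ lower → Class x
    isFixed : x ∈ˡ fixed → Class x
    isUpper : g x ∈ˡ lower → Class x

  lower⁻ : ∀ {x} → x ∈ˡ lower → x <ᶠ g x
  lower⁻ x∈ = proj₂ (∈-filter⁻ (λ x → x <? g x) {xs = allFin n} x∈)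

  lower⁺ : ∀ {x} → x <ᶠ g x → x ∈ˡ lower
  lower⁺ {x} = ∈-filter⁺ _ (∈-allFin x)

  fixed⁻ : ∀ {x} → x ∈ˡ fixed → g x ≡ x × x ≢ e
  fixed⁻ x∈ = proj₂ (∈-filter⁻ (λ x → (g x ≟ x) ×-dec ¬? (x ≟ e)) {xs = allFin n} x∈)

  classify : ∀ x → Class x
  classify x with <-cmp x (g x)
  ... | tri< x<gx _ _ = isLower (lower⁺ x<gx)
  ... | tri> _ _ gx<x = isUpper (lower⁺ (subst (g x <ᶠ_) (sym (inv x)) gx<x))
  ... | tri≈ _ x≡gx _ with x ≟ e
  ...   | yes x≡e = isE x≡e
  ...   | no  x≢e = isFixed (∈-filter⁺ _ (∈-allFin x) (sym x≡gx , x≢e))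

  upper⁻ : ∀ {x} → x ∈ˡ map g lower → g x <ᶠ x
  upper⁻ x∈ with a , a∈ , refl ← ∈-map⁻ g x∈ = subst (_<ᶠ g a) (sym (inv a)) (lower⁻ a∈)

  points : List (Fin n)
  points = e ∷ fixed ++ lower ++ map g lower

  -- The blocks are told apart by g: it fixes e and `fixed`, raises the points of `lower`, and
  -- lowers their images.
  points-unique : Unique points
  points-unique = All.tabulate e∉ ∷
    Unique.++⁺ (Unique.filter⁺ _ (Unique.allFin⁺ n))
      (Unique.++⁺ lower-unique (Unique.map⁺ (involutive⇒injective g inv) lower-unique)
        λ (x∈ , x∈′) → Fin.<-asym (lower⁻ x∈) (upper⁻ x∈′))
      λ (x∈ , x∈′) → moved x∈′ (proj₁ (fixed⁻ x∈))
    where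
    lower-unique : Unique lower
    lower-unique = Unique.filter⁺ _ (Unique.allFin⁺ n)
    moved : ∀ {x} → x ∈ˡ lower ++ map g lower → g x ≢ x
    moved x∈ gx≡x with ∈-++⁻ lower x∈
    ... | inj₁ x∈l = Fin.<⇒≢ (lower⁻ x∈l) (sym gx≡x)
    ... | inj₂ x∈u = Fin.<⇒≢ (upper⁻ x∈u) gx≡x
    e∉ : ∀ {x} → x ∈ˡ fixed ++ lower ++ map g lower → e ≢ x
    e∉ x∈ refl with ∈-++⁻ fixed x∈
    ... | inj₁ e∈f = proj₂ (fixed⁻ e∈f) refl
    ... | inj₂ e∈m = moved e∈m ge≡e

  points-complete : ∀ x → x ∈ˡ points
  points-complete x with classify x
  ... | isE x≡e    = here x≡e
  ... | isFixed x∈ = there (∈-++⁺ˡ x∈)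
  ... | isLower x∈ = there (∈-++⁺ʳ fixed (∈-++⁺ˡ x∈))
  ... | isUpper x∈ = there (∈-++⁺ʳ fixed (∈-++⁺ʳ lower (subst (_∈ˡ map g lower) (inv x) (∈-map⁺ g x∈))))

  points↭allFin : points ↭ allFin n
  points↭allFin = ∼bag⇒↭ (unique∧set⇒bag points-unique (Unique.allFin⁺ n)
    (mk⇔ (λ _ → ∈-allFin _) (λ _ → points-complete _)))

  r f : ℕ
  r = length lower
  f = length fixed

  count : suc (f + (r + r)) ≡ n
  count = begin
    suc (f + (r + r))                              ≡⟨ cong (λ k → suc (f + (r + k))) (length-map g lower) ⟨
    suc (f + (r + length (map g lower)))           ≡⟨ cong (λ k → suc (f + k)) (length-++ lower) ⟨
    suc (f + length (lower ++ map g lower))        ≡⟨ cong suc (length-++ fixed) ⟨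
    length points                                  ≡⟨ ↭-length points↭allFin ⟩
    length (allFin n)                              ≡⟨ length-tabulate {n = n} (λ i → i) ⟩
    n                                              ∎
    where open ≡-Reasoning

  -- Through rank, e gets label 0, the lower points 1, …, r, the other fixed points r + 1, …, r + f, and an upper
  -- point the negative modulo n of the label of its image.
  code : ∀ {x} → Class x → Fin 1 ⊎ (Fin r ⊎ (Fin f ⊎ Fin r))
  code (isE _)      = inj₁ zero
  code (isLower x∈) = inj₂ (inj₁ (index x∈))
  code (isFixed x∈) = inj₂ (inj₂ (inj₁ (index x∈)))
  code (isUpper x∈) = inj₂ (inj₂ (inj₂ (opposite (index x∈))))

  code-injective : ∀ {x y} (c : Class x) (c′ : Class y) → code c ≡ code c′ → x ≡ y
  code-injective (isE x≡e)    (isE y≡e)    eq = trans x≡e (sym y≡e)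
  code-injective (isLower x∈) (isLower y∈) eq = index-injective (setoid _) x∈ y∈ (inj₁-injective (inj₂-injective eq))
  code-injective (isFixed x∈) (isFixed y∈) eq =
    index-injective (setoid _) x∈ y∈ (inj₁-injective (inj₂-injective (inj₂-injective eq)))
  code-injective (isUpper x∈) (isUpper y∈) eq = involutive⇒injective g inv (index-injective (setoid _) x∈ y∈
    (involutive⇒injective opposite opposite-involutive (inj₂-injective (inj₂-injective (inj₂-injective eq)))))

  rank : Fin 1 ⊎ (Fin r ⊎ (Fin f ⊎ Fin r)) → Fin (1 + (r + (f + r)))
  rank = join 1 _ ∘ map₂ (join r _ ∘ map₂ (join f r))

  rank-injective : Injective _≡_ _≡_ rank
  rank-injective {c} {c′} eq = trans (sym (unrank-rank c)) (trans (cong unrank eq) (unrank-rank c′))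
    where
    unrank : Fin (1 + (r + (f + r))) → Fin 1 ⊎ (Fin r ⊎ (Fin f ⊎ Fin r))
    unrank = map₂ (map₂ (splitAt f) ∘ splitAt r) ∘ splitAt 1
    unrank-rank : ∀ c → unrank (rank c) ≡ c
    unrank-rank (inj₁ zero) = refl
    unrank-rank (inj₂ c)
      rewrite splitAt-join 1 (r + (f + r)) (inj₂ (join r _ (map₂ (join f r) c)))
            | splitAt-join r (f + r) (map₂ (join f r) c) with c
    ... | inj₁ i = refl
    ... | inj₂ j rewrite splitAt-join f r j = refl

  label : Fin n → ℕ
  label x = toℕ (rank (code (classify x)))

  label-injective : Injective _≡_ _≡_ label
  label-injective {x} {y} eq = code-injective (classify x) (classify y) (rank-injective (toℕ-injective eq))

  label-< : ∀ x → label x < n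
  label-< x = subst (label x <_) (trans size count) (toℕ<n (rank (code (classify x))))
    where
    arith : ∀ r f → 1 + (r + (f + r)) ≡ suc (f + (r + r))
    arith = solve-∀
    size : 1 + (r + (f + r)) ≡ suc (f + (r + r))
    size = arith r f

  label-e : label e ≡ 0
  label-e with classify e
  ... | isE _      = refl
  ... | isLower e∈ = contradiction (sym ge≡e) (Fin.<⇒≢ (lower⁻ e∈))
  ... | isFixed e∈ = contradiction refl (proj₂ (fixed⁻ e∈))
  ... | isUpper e∈ = contradiction (trans ge≡e (sym (inv e))) (Fin.<⇒≢ (lower⁻ e∈))

  -- The ranks are 1 + i and 1 + r + f + (r - 1 - i), with sum 1 + f + 2r.
  rank-lower+upper : ∀ i → toℕ (rank (inj₂ (inj₁ i))) + toℕ (rank (inj₂ (inj₂ (inj₂ (opposite i))))) ≡ n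
  rank-lower+upper i = begin
    toℕ (rank (inj₂ (inj₁ i))) + toℕ (rank (inj₂ (inj₂ (inj₂ (opposite i)))))
      ≡⟨ cong₂ (λ a b → suc a + suc b) (toℕ-↑ˡ i (f + r)) (trans (toℕ-↑ʳ r _) (cong (r +_) (toℕ-↑ʳ f _))) ⟩
    suc (toℕ i) + suc (r + (f + toℕ (opposite i)))
      ≡⟨ cong (λ k → suc (toℕ i) + suc (r + (f + k))) (opposite-prop i) ⟩
    suc (toℕ i) + suc (r + (f + (r ∸ suc (toℕ i))))
      ≡⟨ arith (suc (toℕ i)) r f (r ∸ suc (toℕ i)) ⟩
    suc (f + (r + (suc (toℕ i) + (r ∸ suc (toℕ i)))))
      ≡⟨ cong (λ k → suc (f + (r + k))) (ℕ.m+[n∸m]≡n (toℕ<n i)) ⟩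
    suc (f + (r + r))
      ≡⟨ count ⟩
    n ∎
    where
    open ≡-Reasoning
    arith : ∀ a r f b → a + suc (r + (f + b)) ≡ suc (f + (r + (a + b)))
    arith = solve-∀

  -- `classify` finds x and `g (g x)` in `lower` by separate proofs; as the list has no repetitions,
  -- both give the same position.
  lower-irrelevant : ∀ {x y} (p : x ∈ˡ lower) (q : y ∈ˡ lower) → x ≡ y → index p ≡ index q
  lower-irrelevant p q refl = cong index (unique⇒irrelevant (Unique.filter⁺ _ (Unique.allFin⁺ n)) p q)

  -- Of the two points of a 2-cycle one is lower and the other upper, with mirrored positions; all
  -- other combinations of classes are contradictory.
  label-cycle : ∀ {x} → g x ≢ x → label x + label (g x) ≡ n
  label-cycle {x} gx≢x with classify x | classify (g x)
  ... | isE refl    | _            = contradiction ge≡e gx≢x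
  ... | isFixed x∈  | _            = contradiction (proj₁ (fixed⁻ x∈)) gx≢x
  ... | _           | isE gx≡e     = contradiction (involutive⇒injective g inv (trans (cong g gx≡e) (trans ge≡e (sym gx≡e)))) gx≢x
  ... | _           | isFixed gx∈  = contradiction (involutive⇒injective g inv (proj₁ (fixed⁻ gx∈))) gx≢x
  ... | isLower x∈  | isLower gx∈  = contradiction (subst (g x <ᶠ_) (inv x) (lower⁻ gx∈)) (Fin.<-asym (lower⁻ x∈))
  ... | isUpper gx∈ | isUpper ggx∈ = contradiction (subst (λ y → g (g x) <ᶠ g y) (inv x) (lower⁻ ggx∈)) (Fin.<-asym (lower⁻ gx∈))
  ... | isLower x∈  | isUpper ggx∈ rewrite lower-irrelevant ggx∈ x∈ (inv x) = rank-lower+upper (index x∈)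
  ... | isUpper gx∈ | isLower gx∈′ rewrite lower-irrelevant gx∈ gx∈′ refl =
    trans (ℕ.+-comm (toℕ (rank (code (isUpper {x} gx∈′)))) _) (rank-lower+upper (index gx∈′))

-- Cycle structure of an involution

concat-pairs : ∀ {A : Set} (h : A → A) xs → concat (map (λ x → x ∷ h x ∷ []) xs) ↭ xs ++ map h xs
concat-pairs h []       = ↭-refl
concat-pairs h (x ∷ xs) = prep x (↭-trans (prep (h x) (concat-pairs h xs)) (↭-sym (shift (h x) xs (map h xs))))

map-const : ∀ {A B : Set} (b : B) (xs : List A) → map (λ _ → b) xs ≡ replicate (length xs) b
map-const b []       = refl
map-const b (x ∷ xs) = cong (b ∷_) (map-const b xs)

module _ (γ : Permutation′ n) where

  private
    g : Fin n → Fin n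
    g = γ ⟨$⟩ʳ_

  involution⇒cycles : γ ∘ₚ γ ≈ id × (∃[ x ] g x ≡ x) →
                      ∃[ r ] ∃[ f ] (f ≥ 1 × HasCycleStructure γ ((2 , r) ∷ (1 , f) ∷ []))
  -- `f` counts the fixed points other than e, so there are `suc f` cycles of length 1.
  involution⇒cycles (inv , e , ge≡e) = r , suc f , s≤s z≤n , twos ++ ones , cyclic , covering , ↭-reflexive lengths
    where
    open Involution g inv ge≡e
    twos ones : List (List (Fin n))
    twos = map (λ x → x ∷ g x ∷ []) lower
    ones = map (_∷ []) (e ∷ fixed)

    cyclic : All (IsCycle γ) (twos ++ ones)
    cyclic = All.++⁺ (All.map⁺ (All.tabulate λ {x} _ → cycle (cong (λ y → g x ∷ y ∷ []) (inv x))))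
                     (All.map⁺ (cycle (cong (_∷ []) ge≡e) ∷ All.tabulate λ x∈ → cycle (cong (_∷ []) (proj₁ (fixed⁻ x∈)))))

    covering : concat (twos ++ ones) ↭ allFin n
    covering = begin
      concat (twos ++ ones)                   ≡⟨ concat-++ twos ones ⟨
      concat twos ++ concat ones              ≡⟨ cong (concat twos ++_) (concat-map-[_] (e ∷ fixed)) ⟩
      concat twos ++ e ∷ fixed                ↭⟨ ++⁺ʳ (e ∷ fixed) (concat-pairs g lower) ⟩
      (lower ++ map g lower) ++ e ∷ fixed     ↭⟨ ++-comm (lower ++ map g lower) (e ∷ fixed) ⟩
      points                                  ↭⟨ points↭allFin ⟩
      allFin n                                ∎
      where open PermutationReasoning

    lengths : map length (twos ++ ones) ≡ cycleLengths ((2 , r) ∷ (1 , suc f) ∷ [])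
    lengths = begin
      map length (twos ++ ones)                 ≡⟨ map-++ length twos ones ⟩
      map length twos ++ map length ones        ≡⟨ cong₂ _++_ (map-∘ lower) (map-∘ (e ∷ fixed)) ⟨
      map (λ _ → 2) lower ++ map (λ _ → 1) (e ∷ fixed)
        ≡⟨ cong₂ _++_ (map-const 2 lower) (map-const 1 (e ∷ fixed)) ⟩
      replicate r 2 ++ replicate (suc f) 1      ≡⟨ cong (replicate r 2 ++_) (++-identityʳ _) ⟨
      cycleLengths ((2 , r) ∷ (1 , suc f) ∷ []) ∎
      where open ≡-Reasoning

  cycles⇒involution : ∃[ r ] ∃[ f ] (f ≥ 1 × HasCycleStructure γ ((2 , r) ∷ (1 , f) ∷ [])) →
                      γ ∘ₚ γ ≈ id × (∃[ x ] g x ≡ x)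
  cycles⇒involution (r , suc f , _ , cycles , cyclic , covering , lengths) = inv , fixedPoint
    where
    short : ∀ {k} → k ∈ˡ cycleLengths ((2 , r) ∷ (1 , suc f) ∷ []) → k ≡ 2 ⊎ k ≡ 1
    short k∈ with ∈-++⁻ (replicate r 2) k∈
    ... | inj₁ k∈₂ = inj₁ (All.lookup {P = _≡ 2} (All.replicate⁺ r refl) k∈₂)
    ... | inj₂ k∈₁ with ∈-++⁻ (replicate (suc f) 1) k∈₁
    ...   | inj₁ k∈₁′ = inj₂ (All.lookup {P = _≡ 1} (All.replicate⁺ (suc f) refl) k∈₁′)

    short-inv : ∀ {c x} → length c ≡ 2 ⊎ length c ≡ 1 → IsCycle γ c → x ∈ˡ c → g (g x) ≡ x
    short-inv {_ ∷ []}     _ (cycle eq) (here refl) with gx≡x ← ∷-injectiveˡ eq = trans (cong g gx≡x) gx≡x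
    short-inv {x ∷ y ∷ []} _ (cycle eq) (here refl) = trans (cong g (∷-injectiveˡ eq)) (∷-injectiveˡ (∷-injectiveʳ eq))
    short-inv {x ∷ y ∷ []} _ (cycle eq) (there (here refl)) = trans (cong g (∷-injectiveˡ (∷-injectiveʳ eq))) (∷-injectiveˡ eq)
    short-inv {_ ∷ _ ∷ _ ∷ _} (inj₁ ())
    short-inv {_ ∷ _ ∷ _ ∷ _} (inj₂ ())

    inv : γ ∘ₚ γ ≈ id
    inv x with c , x∈c , c∈ ← ∈-concat⁻′ cycles (∈-resp-↭ (↭-sym covering) (∈-allFin x)) =
      short-inv (short (∈-resp-↭ lengths (∈-map⁺ length c∈))) (All.lookup cyclic c∈) x∈c

    fixedPoint : ∃[ x ] g x ≡ x
    -- As f is positive, 1 occurs among the prescribed lengths, so some cycle has length 1.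
    fixedPoint with ∈-map⁻ length (∈-resp-↭ (↭-sym lengths) (∈-++⁺ʳ (replicate r 2) (here refl)))
    ... | (x ∷ []) , c∈ , _ with cycle eq ← All.lookup cyclic c∈ = x , ∷-injectiveˡ eq

  Par⇒involution : .{{NonZero n}} → ⟨ id , id , γ ⨾ [12] ⟩ ∈ Par n → γ ∘ₚ γ ≈ id × (∃[ x ] g x ≡ x)
  Par⇒involution par@(L , _) = inv , entry L o o , sym (skew o o)
    where
    skew : Skew g (entry L)
    skew = Par⇒skew γ par
    o : Fin n
    o = fromℕ< (>-nonZero⁻¹ n)
    inv : γ ∘ₚ γ ≈ id
    -- Every z stands somewhere in row o, and transposing its cell twice applies γ twice.
    inv z with y , refl , _ ← rowLatin L o z = trans (cong g (sym (skew o y))) (sym (skew y o))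

-- The two parities of the order

relabel : (Q : SymmetricSquare n) → Permutation′ n → SymmetricSquare n
relabel Q π = record
  { _∙_    = λ x y → π ⟨$⟩ʳ (x ∙ y)
  ; comm   = λ x y → cong (π ⟨$⟩ʳ_) (comm x y)
  ; cancel = λ x eq → cancel x (Injection.injective (↔⇒↣ π) eq)
  }
  where open SymmetricSquare Q

module OddOrder k (γ : Permutation′ (suc (k * 2))) (inv : γ ∘ₚ γ ≈ id) {e} (ge≡e : γ ⟨$⟩ʳ e ≡ e) where
  open Involution (γ ⟨$⟩ʳ_) inv ge≡e
  open Mean (odd-coprime-2 k) label-< label-injective
  open SymmetricSquare mean

  -- The two labels add up to n, which is congruent to twice the label 0 of e.
  mean-cycle : ∀ {x} → γ ⟨$⟩ʳ x ≢ x → x ∙ (γ ⟨$⟩ʳ x) ≡ e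
  mean-cycle {x} moved = mean-unique {x} {γ ⟨$⟩ʳ x} {e} (trans (cong (_% suc (k * 2)) (label-cycle moved))
    (trans (n%n≡0 (suc (k * 2))) (cong (λ l → (l + l) % suc (k * 2)) (sym label-e))))

  oddPar : ⟨ id , id , γ ⨾ [12] ⟩ ∈ Par (suc (k * 2))
  oddPar = skew⇒Par γ inv (idempotent⇒skewSquare (γ ⟨$⟩ʳ_) inv mean mean-idempotent ge≡e mean-cycle)

module EvenOrder k (γ : Permutation′ (suc (suc (k * 2)))) (inv : γ ∘ₚ γ ≈ id) {e} (ge≡e : γ ⟨$⟩ʳ e ≡ e) where
  open Mean (odd-coprime-2 k) toℕ<n toℕ-injective
  open Extension mean mean-idempotent

  -- Adjoining ∞ to the mean square of odd order gives even order; the transposition then renames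
  -- the diagonal symbol ∞ to the fixed point e.
  square : SymmetricSquare (suc (suc (k * 2)))
  square = relabel extension (transpose zero e)

  square-unipotent : ∀ x → SymmetricSquare._∙_ square x x ≡ e
  square-unipotent x = cong (transpose zero e ⟨$⟩ʳ_) (extension-unipotent x)

  evenPar : ⟨ id , id , γ ⨾ [12] ⟩ ∈ Par (suc (suc (k * 2)))
  evenPar = skew⇒Par γ inv (unipotent⇒skewSquare (γ ⟨$⟩ʳ_) inv square ge≡e square-unipotent)

involution⇒Par : ∀ n .{{_ : NonZero n}} (γ : Permutation′ n) →
                 γ ∘ₚ γ ≈ id × (∃[ x ] γ ⟨$⟩ʳ x ≡ x) → ⟨ id , id , γ ⨾ [12] ⟩ ∈ Par n
involution⇒Par n γ (inv , e , ge≡e) with n divMod 2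
-- Order 0 has no point that could serve as e.
... | result zero    zero refl with () ← e
... | result (suc k) zero refl       = EvenOrder.evenPar k γ inv ge≡e
... | result k       (suc zero) refl = OddOrder.oddPar k γ inv ge≡e

theorem4p7 : (n : ℕ) .{{_ : NonZero n}} (γ : Permutation′ n) →
    (⟨ id , id , γ ⨾ [12] ⟩ ∈ Par n ⇔
    (∃[ r ] ∃[ f ] (f ≥ 1 × HasCycleStructure γ ((2 , r) ∷ (1 , f) ∷ []))))
    ×
    ((∃[ r ] ∃[ f ] (f ≥ 1 × HasCycleStructure γ ((2 , r) ∷ (1 , f) ∷ []))) ⇔
    (γ ∘ₚ γ ≈ id × (∃[ x ] γ ⟨$⟩ʳ x ≡ x)))
theorem4p7 n γ =
  mk⇔ (involution⇒cycles γ ∘ Par⇒involution γ) (involution⇒Par n γ ∘ cycles⇒involution γ) ,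
  mk⇔ (cycles⇒involution γ) (involution⇒cycles γ)
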